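{- Let $m$ and $n$ be positive integers. Then $$\frac{1-q}{1-q^{m+n}}{m+n-2\brack m-1}_q{n\brack m}_q{2n\brack n}_q$$ is a polynomial in $q$ with non-negative integer coefficients.
   Context: The $q$-binomial coefficients are defined by ${n\brack k}_q=\prod_{i=1}^{k}\frac{1-q^{n-k+i}}{1-q^i}$ if $0\le k\le n$, and ${n\brack k}_q=0$ otherwise. -}

module Defs where

open import Data.Empty using (⊥-elim)
open import Data.Integer as ℤ using (ℤ; 0ℤ; 1ℤ)
import Data.Integer.Properties as ℤₚ
open import Data.List.Base using (List; []; _∷_; [_]; map; replicate; _++_)
open import Data.Nat.Base as ℕ using (ℕ; zero; suc; _∸_; NonZero; ≢-nonZero⁻¹)
open import Data.Nat.Properties using (_≤?_)
open import Data.Product.Base using (∃-syntax; _×_)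
open import Data.Sum.Base using (_⊎_; inj₁; inj₂)
open import Relation.Binary.PropositionalEquality
  using (_≡_; refl; sym; trans; cong)
open import Relation.Nullary using (¬_; yes; no)

infix  4 _≈ₚ_ _≃_
infixl 6 _+ₚ_ _-ₚ_
infixl 7 _*ₚ_ _·ₚ_ _*_

-- Polynomials in q over ℤ, as coefficient lists with the constant term first.
-- Trailing zeros are allowed, so equality is _≈ₚ_ rather than _≡_.

ℤ[q] : Set
ℤ[q] = List ℤ

coeff : ℤ[q] → ℕ → ℤ
coeff []      _       = 0ℤ
coeff (a ∷ _) zero    = a
coeff (_ ∷ p) (suc i) = coeff p i

_≈ₚ_ : ℤ[q] → ℤ[q] → Set
p ≈ₚ r = ∀ i → coeff p i ≡ coeff r i

0ₚ 1ₚ : ℤ[q]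
0ₚ = []
1ₚ = [ 1ℤ ]

q^_ : ℕ → ℤ[q]
q^ n = replicate n 0ℤ ++ [ 1ℤ ]

_+ₚ_ : ℤ[q] → ℤ[q] → ℤ[q]
[]      +ₚ r       = r
(a ∷ p) +ₚ []      = a ∷ p
(a ∷ p) +ₚ (b ∷ r) = (a ℤ.+ b) ∷ (p +ₚ r)

_·ₚ_ : ℤ → ℤ[q] → ℤ[q]
a ·ₚ p = map (a ℤ.*_) p

_-ₚ_ : ℤ[q] → ℤ[q] → ℤ[q]
p -ₚ r = p +ₚ map ℤ.-_ r

_*ₚ_ : ℤ[q] → ℤ[q] → ℤ[q]
[]      *ₚ r = []
(a ∷ p) *ₚ r = (a ·ₚ r) +ₚ (0ℤ ∷ (p *ₚ r))

1-q^_ : ℕ → ℤ[q]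
1-q^ n = 1ₚ -ₚ q^ n

coeff-+ : ∀ p r i → coeff (p +ₚ r) i ≡ coeff p i ℤ.+ coeff r i
coeff-+ []      r       i       = sym (ℤₚ.+-identityˡ _)
coeff-+ (a ∷ p) []      i       = sym (ℤₚ.+-identityʳ _)
coeff-+ (a ∷ p) (b ∷ r) zero    = refl
coeff-+ (a ∷ p) (b ∷ r) (suc i) = coeff-+ p r i

coeff-· : ∀ a p i → coeff (a ·ₚ p) i ≡ a ℤ.* coeff p i
coeff-· a []      i       = sym (ℤₚ.*-zeroʳ a)
coeff-· a (b ∷ p) zero    = refl
coeff-· a (b ∷ p) (suc i) = coeff-· a p i

coeff-*-zero : ∀ a p r → coeff ((a ∷ p) *ₚ r) 0 ≡ a ℤ.* coeff r 0
coeff-*-zero a p r = trans (coeff-+ (a ·ₚ r) _ 0)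
  (trans (ℤₚ.+-identityʳ _) (coeff-· a r 0))

coeff-*-suc : ∀ a p r i →
  coeff ((a ∷ p) *ₚ r) (suc i) ≡ a ℤ.* coeff r (suc i) ℤ.+ coeff (p *ₚ r) i
coeff-*-suc a p r i = trans (coeff-+ (a ·ₚ r) _ (suc i))
  (cong (ℤ._+ coeff (p *ₚ r) i) (coeff-· a r (suc i)))

*ₚ-shiftʳ-zero : ∀ p b r → b ≡ 0ℤ → coeff (p *ₚ (b ∷ r)) 0 ≡ 0ℤ
*ₚ-shiftʳ-zero []      b r b≡0  = refl
*ₚ-shiftʳ-zero (a ∷ p) b r refl = trans (coeff-*-zero a p (b ∷ r)) (ℤₚ.*-zeroʳ a)

*ₚ-shiftʳ-suc : ∀ p b r → b ≡ 0ℤ → ∀ i →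
  coeff (p *ₚ (b ∷ r)) (suc i) ≡ coeff (p *ₚ r) i
*ₚ-shiftʳ-suc []      b r b≡0 i = refl
*ₚ-shiftʳ-suc (a ∷ p) b r b≡0 zero =
  trans (coeff-*-suc a p (b ∷ r) 0)
  (trans (cong (ℤ._+_ (a ℤ.* coeff r 0)) (*ₚ-shiftʳ-zero p b r b≡0))
  (trans (ℤₚ.+-identityʳ _) (sym (coeff-*-zero a p r))))
*ₚ-shiftʳ-suc (a ∷ p) b r b≡0 (suc i) =
  trans (coeff-*-suc a p (b ∷ r) (suc i))
  (trans (cong (ℤ._+_ (a ℤ.* coeff r (suc i))) (*ₚ-shiftʳ-suc p b r b≡0 i))
  (sym (coeff-*-suc a p r i)))

∷≈0 : ∀ {a p} → a ≡ 0ℤ → p ≈ₚ 0ₚ → (a ∷ p) ≈ₚ 0ₚ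
∷≈0 a≡0 p≈0 zero    = a≡0
∷≈0 a≡0 p≈0 (suc i) = p≈0 i

*ₚ-cancel-const : ∀ a p r → ¬ (a ≡ 0ℤ) → ((a ∷ p) *ₚ r) ≈ₚ 0ₚ → r ≈ₚ 0ₚ
*ₚ-cancel-const a p []      a≢0 e = λ _ → refl
*ₚ-cancel-const a p (b ∷ r) a≢0 e
  with ℤₚ.i*j≡0⇒i≡0∨j≡0 a (trans (sym (coeff-*-zero a p (b ∷ r))) (e 0))
... | inj₁ a≡0 = ⊥-elim (a≢0 a≡0)
... | inj₂ b≡0 = ∷≈0 b≡0 (*ₚ-cancel-const a p r a≢0 λ i →
        trans (sym (*ₚ-shiftʳ-suc (a ∷ p) b r b≡0 i)) (e (suc i)))

*ₚ-integral : ∀ p r → (p *ₚ r) ≈ₚ 0ₚ → p ≈ₚ 0ₚ ⊎ r ≈ₚ 0ₚ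
*ₚ-integral []      r e = inj₁ λ _ → refl
*ₚ-integral (a ∷ p) r e with a ℤ.≟ 0ℤ
... | no  a≢0 = inj₂ (*ₚ-cancel-const a p r a≢0 e)
... | yes refl with *ₚ-integral p r (λ i → trans
        (sym (trans (coeff-*-suc 0ℤ p r i) (ℤₚ.+-identityˡ _))) (e (suc i)))
...   | inj₁ p≈0 = inj₁ (∷≈0 refl p≈0)
...   | inj₂ r≈0 = inj₂ r≈0

*ₚ-≉0 : ∀ p r → ¬ (p ≈ₚ 0ₚ) → ¬ (r ≈ₚ 0ₚ) → ¬ ((p *ₚ r) ≈ₚ 0ₚ)
*ₚ-≉0 p r p≉0 r≉0 e with *ₚ-integral p r e
... | inj₁ p≈0 = p≉0 p≈0
... | inj₂ r≈0 = r≉0 r≈0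

1ₚ≉0 : ¬ (1ₚ ≈ₚ 0ₚ)
1ₚ≉0 e with () ← e 0

1-q^n≉0 : ∀ n .{{_ : NonZero n}} → ¬ ((1-q^ n) ≈ₚ 0ₚ)
1-q^n≉0 zero {{nz}} _ = ≢-nonZero⁻¹ 0 {{nz}} refl
1-q^n≉0 (suc n) e with () ← e 0

-- The field of fractions of ℤ[q], that is, ℚ(q).

record ℚ⟨q⟩ : Set where
  constructor mkℚ⟨q⟩
  field
    num   : ℤ[q]
    den   : ℤ[q]
    den≉0 : ¬ (den ≈ₚ 0ₚ)

open ℚ⟨q⟩ public

_≃_ : ℚ⟨q⟩ → ℚ⟨q⟩ → Set
x ≃ y = (num x *ₚ den y) ≈ₚ (num y *ₚ den x)

fromPoly : ℤ[q] → ℚ⟨q⟩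
fromPoly p = mkℚ⟨q⟩ p 1ₚ 1ₚ≉0

_*_ : ℚ⟨q⟩ → ℚ⟨q⟩ → ℚ⟨q⟩
x * y = mkℚ⟨q⟩ (num x *ₚ num y) (den x *ₚ den y) (*ₚ-≉0 (den x) (den y) (den≉0 x) (den≉0 y))

[1-q^_]/[1-q^_] : (a b : ℕ) .{{_ : NonZero b}} → ℚ⟨q⟩
[1-q^ a ]/[1-q^ b ] = mkℚ⟨q⟩ (1-q^ a) (1-q^ b) (1-q^n≉0 b)

-- ∏₁ k f is the product of f i over 1 ≤ i ≤ k.

∏₁ : ℕ → ((i : ℕ) .{{_ : NonZero i}} → ℚ⟨q⟩) → ℚ⟨q⟩
∏₁ zero    f = fromPoly 1ₚ
∏₁ (suc k) f = ∏₁ k f * f (suc k)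

qbinom : ℕ → ℕ → ℚ⟨q⟩
qbinom n k with k ≤? n
... | yes _ = ∏₁ k λ i → [1-q^ n ∸ k ℕ.+ i ]/[1-q^ i ]
... | no  _ = fromPoly 0ₚ

IsNonNegPolynomial : ℚ⟨q⟩ → Set
IsNonNegPolynomial x = ∃[ p ] (x ≃ fromPoly p × (∀ i → 0ℤ ℤ.≤ coeff p i))

instance
  +-nonZero : ∀ {m n} .{{_ : NonZero m}} → NonZero (m ℕ.+ n)
  +-nonZero {suc m} = _

{-# OPTIONS --safe #-}
module Submission where

-- Put k = m - 1 and N = m + n - 2. After cancelling q-factorials the product is
--   [2n choose n - m] ([N choose k]² - q [N choose k - 1] [N choose k + 1]).
-- The second factor is a q-Narayana number. It is the case i = j = k of the minors
--   T(N; i, j) = [N choose i] [N choose j] - q^(j - i + 1) [N choose i - 1] [N choose j + 1],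
-- which vanish for j = i - 1, and Pascal's rule gives
--   T(N + 1; i, j) = q^(i + j) T(N; i, j) + q^i T(N; i, j - 1)
--                    + q^j T(N; i - 1, j) + T(N; i - 1, j - 1).
-- By induction on N they have non-negative coefficients whenever i ≤ j + 1.

open import Defs
open import Algebra.Bundles using (CommutativeRing)
open import Data.Integer.Base as ℤ using (ℤ; 0ℤ; 1ℤ)
import Data.Integer.Properties as ℤₚ
open import Data.List.Base using ([]; _∷_; map)
open import Data.Maybe.Base using (Maybe; just; nothing)
import Data.Maybe.Base as Maybe
open import Data.Nat.Base using (ℕ; zero; suc; _+_; _∸_; NonZero; _≤_; _<_; s<s)
import Data.Nat.Base as ℕ
import Data.Nat.Properties as ℕₚ
open import Data.Product.Base using (_,_)
open import Data.Sum.Base using (inj₁; inj₂)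
open import Level using (0ℓ)
open import Relation.Binary.PropositionalEquality
  using (_≡_; refl; sym; trans; cong; cong₂; subst; subst₂)
open import Relation.Binary.Structures using (IsEquivalence)
open import Relation.Nullary using (¬_; yes; no; contradiction)
import Relation.Binary.Reasoning.Setoid as ≋-Reasoning
import Tactic.RingSolver.Core.AlmostCommutativeRing as ACR
open import Tactic.RingSolver using (solve-∀)

-- The commutative ring of polynomials in q, and its ring solver.

infix 4 _≋_
infix 8 -ₚ_

-- Unlike _≈ₚ_, a record type determines p and r, so they can stay implicit.
record _≋_ (p r : ℤ[q]) : Set where
  constructor coeffs
  field at : p ≈ₚ r
open _≋_

-ₚ_ : ℤ[q] → ℤ[q]
-ₚ p = map ℤ.-_ p

≋-isEquivalence : IsEquivalence _≋_
≋-isEquivalence = record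
  { refl  = coeffs λ _ → refl
  ; sym   = λ e → coeffs λ i → sym (at e i)
  ; trans = λ e f → coeffs λ i → trans (at e i) (at f i)
  }

open IsEquivalence ≋-isEquivalence
  using () renaming (refl to ≋-refl; sym to ≋-sym; trans to ≋-trans; reflexive to ≋-reflexive)

+ₚ-cong : ∀ {p p′ r r′} → p ≋ p′ → r ≋ r′ → p +ₚ r ≋ p′ +ₚ r′
+ₚ-cong {p} {p′} {r} {r′} e f = coeffs λ i →
  trans (coeff-+ p r i) (trans (cong₂ ℤ._+_ (at e i) (at f i)) (sym (coeff-+ p′ r′ i)))

+ₚ-comm : ∀ p r → p +ₚ r ≋ r +ₚ p
+ₚ-comm p r = coeffs λ i →
  trans (coeff-+ p r i) (trans (ℤₚ.+-comm (coeff p i) (coeff r i)) (sym (coeff-+ r p i)))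

+ₚ-assoc : ∀ p r s → (p +ₚ r) +ₚ s ≋ p +ₚ (r +ₚ s)
+ₚ-assoc p r s = coeffs λ i →
  trans (coeff-+ (p +ₚ r) s i)
  (trans (cong (ℤ._+ coeff s i) (coeff-+ p r i))
  (trans (ℤₚ.+-assoc (coeff p i) (coeff r i) (coeff s i))
  (sym (trans (coeff-+ p (r +ₚ s) i) (cong (ℤ._+_ (coeff p i)) (coeff-+ r s i))))))

+ₚ-identityʳ : ∀ p → p +ₚ 0ₚ ≋ p
+ₚ-identityʳ p = +ₚ-comm p 0ₚ

coeff-neg : ∀ p i → coeff (-ₚ p) i ≡ ℤ.- coeff p i
coeff-neg []      i       = refl
coeff-neg (a ∷ p) zero    = refl
coeff-neg (a ∷ p) (suc i) = coeff-neg p i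

-ₚ-cong : ∀ {p r} → p ≋ r → -ₚ p ≋ -ₚ r
-ₚ-cong {p} {r} e = coeffs λ i →
  trans (coeff-neg p i) (trans (cong ℤ.-_ (at e i)) (sym (coeff-neg r i)))

-ₚ-inverseʳ : ∀ p → p +ₚ -ₚ p ≋ 0ₚ
-ₚ-inverseʳ p = coeffs λ i → trans (coeff-+ p (-ₚ p) i)
  (trans (cong (ℤ._+_ (coeff p i)) (coeff-neg p i)) (ℤₚ.+-inverseʳ (coeff p i)))

-ₚ-inverseˡ : ∀ p → -ₚ p +ₚ p ≋ 0ₚ
-ₚ-inverseˡ p = ≋-trans (+ₚ-comm (-ₚ p) p) (-ₚ-inverseʳ p)

∷-cong : ∀ {a b p r} → a ≡ b → p ≋ r → a ∷ p ≋ b ∷ r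
∷-cong {a} {b} {p} {r} e f = coeffs go
  where
  go : (a ∷ p) ≈ₚ (b ∷ r)
  go zero    = e
  go (suc i) = at f i

·ₚ-cong : ∀ a {p r} → p ≋ r → a ·ₚ p ≋ a ·ₚ r
·ₚ-cong a {p} {r} e = coeffs λ i →
  trans (coeff-· a p i) (trans (cong (ℤ._*_ a) (at e i)) (sym (coeff-· a r i)))

0·ₚ : ∀ p → 0ℤ ·ₚ p ≋ 0ₚ
0·ₚ p = coeffs λ i → trans (coeff-· 0ℤ p i) (ℤₚ.*-zeroˡ (coeff p i))

1·ₚ : ∀ p → 1ℤ ·ₚ p ≋ p
1·ₚ p = coeffs λ i → trans (coeff-· 1ℤ p i) (ℤₚ.*-identityˡ (coeff p i))

·ₚ-distribˡ : ∀ a p r → a ·ₚ (p +ₚ r) ≋ a ·ₚ p +ₚ a ·ₚ r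
·ₚ-distribˡ a p r = coeffs λ i →
  trans (coeff-· a (p +ₚ r) i)
  (trans (cong (ℤ._*_ a) (coeff-+ p r i))
  (trans (ℤₚ.*-distribˡ-+ a (coeff p i) (coeff r i))
  (sym (trans (coeff-+ (a ·ₚ p) (a ·ₚ r) i) (cong₂ ℤ._+_ (coeff-· a p i) (coeff-· a r i))))))

·ₚ-distribʳ : ∀ a b p → (a ℤ.+ b) ·ₚ p ≋ a ·ₚ p +ₚ b ·ₚ p
·ₚ-distribʳ a b p = coeffs λ i →
  trans (coeff-· (a ℤ.+ b) p i)
  (trans (ℤₚ.*-distribʳ-+ (coeff p i) a b)
  (sym (trans (coeff-+ (a ·ₚ p) (b ·ₚ p) i) (cong₂ ℤ._+_ (coeff-· a p i) (coeff-· b p i)))))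

·ₚ-assoc : ∀ a b p → (a ℤ.* b) ·ₚ p ≋ a ·ₚ (b ·ₚ p)
·ₚ-assoc a b p = coeffs λ i →
  trans (coeff-· (a ℤ.* b) p i)
  (trans (ℤₚ.*-assoc a b (coeff p i))
  (sym (trans (coeff-· a (b ·ₚ p) i) (cong (ℤ._*_ a) (coeff-· b p i)))))

+ₚ-interchange : ∀ p r s t → (p +ₚ r) +ₚ (s +ₚ t) ≋ (p +ₚ s) +ₚ (r +ₚ t)
+ₚ-interchange p r s t =
  ≋-trans (+ₚ-assoc p r (s +ₚ t))
  (≋-trans (+ₚ-cong {p} ≋-refl
    (≋-trans (≋-sym (+ₚ-assoc r s t))
    (≋-trans (+ₚ-cong (+ₚ-comm r s) ≋-refl) (+ₚ-assoc s r t))))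
  (≋-sym (+ₚ-assoc p s (r +ₚ t))))

*ₚ-congˡ : ∀ p {r s} → r ≋ s → p *ₚ r ≋ p *ₚ s
*ₚ-congˡ []      e = ≋-refl
*ₚ-congˡ (a ∷ p) e = +ₚ-cong (·ₚ-cong a e) (∷-cong refl (*ₚ-congˡ p e))

*ₚ-zeroʳ : ∀ p → p *ₚ 0ₚ ≋ 0ₚ
*ₚ-zeroʳ []      = ≋-refl
*ₚ-zeroʳ (a ∷ p) = coeffs (∷≈0 refl (at (*ₚ-zeroʳ p)))

-- Multiplication recurses on its left factor; this mirror image of the recursion is what
-- commutativity needs.
*ₚ-∷ʳ : ∀ p b r → p *ₚ (b ∷ r) ≋ b ·ₚ p +ₚ (0ℤ ∷ (p *ₚ r))
*ₚ-∷ʳ []      b r = ≋-sym (coeffs (∷≈0 refl λ _ → refl))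
*ₚ-∷ʳ (a ∷ p) b r = ∷-cong (cong (ℤ._+ 0ℤ) (ℤₚ.*-comm a b))
  (≋-trans (+ₚ-cong {a ·ₚ r} ≋-refl (*ₚ-∷ʳ p b r))
  (≋-trans (≋-sym (+ₚ-assoc (a ·ₚ r) (b ·ₚ p) (0ℤ ∷ (p *ₚ r))))
  (≋-trans (+ₚ-cong (+ₚ-comm (a ·ₚ r) (b ·ₚ p)) ≋-refl)
  (+ₚ-assoc (b ·ₚ p) (a ·ₚ r) (0ℤ ∷ (p *ₚ r))))))

*ₚ-comm : ∀ p r → p *ₚ r ≋ r *ₚ p
*ₚ-comm []      r = ≋-sym (*ₚ-zeroʳ r)
*ₚ-comm (a ∷ p) r =
  ≋-trans (+ₚ-cong {a ·ₚ r} ≋-refl (∷-cong refl (*ₚ-comm p r))) (≋-sym (*ₚ-∷ʳ r a p))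

-- Equal polynomials may have lists of different lengths, which hinders an induction along the left
-- factor; commutativity moves that case to the right factor.
*ₚ-cong : ∀ {p p′ r r′} → p ≋ p′ → r ≋ r′ → p *ₚ r ≋ p′ *ₚ r′
*ₚ-cong {p} {p′} {r} {r′} e f =
  ≋-trans (*ₚ-congˡ p f) (≋-trans (*ₚ-comm p r′) (≋-trans (*ₚ-congˡ r′ e) (*ₚ-comm r′ p′)))

*ₚ-distribʳ : ∀ s p r → (p +ₚ r) *ₚ s ≋ p *ₚ s +ₚ r *ₚ s
*ₚ-distribʳ s []      r       = ≋-refl
*ₚ-distribʳ s (a ∷ p) []      = ≋-sym (+ₚ-identityʳ ((a ∷ p) *ₚ s))
*ₚ-distribʳ s (a ∷ p) (b ∷ r) =
  ≋-trans (+ₚ-cong (·ₚ-distribʳ a b s) (∷-cong {0ℤ} refl (*ₚ-distribʳ s p r)))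
  (+ₚ-interchange (a ·ₚ s) (b ·ₚ s) (0ℤ ∷ (p *ₚ s)) (0ℤ ∷ (r *ₚ s)))

*ₚ-distribˡ : ∀ s p r → s *ₚ (p +ₚ r) ≋ s *ₚ p +ₚ s *ₚ r
*ₚ-distribˡ s p r = ≋-trans (*ₚ-comm s (p +ₚ r))
  (≋-trans (*ₚ-distribʳ s p r) (+ₚ-cong (*ₚ-comm p s) (*ₚ-comm r s)))

·ₚ-*ₚ : ∀ a p r → (a ·ₚ p) *ₚ r ≋ a ·ₚ (p *ₚ r)
·ₚ-*ₚ a []      r = ≋-refl
·ₚ-*ₚ a (b ∷ p) r =
  ≋-trans (+ₚ-cong (·ₚ-assoc a b r) (∷-cong (sym (ℤₚ.*-zeroʳ a)) (·ₚ-*ₚ a p r)))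
  (≋-sym (·ₚ-distribˡ a (b ·ₚ r) (0ℤ ∷ (p *ₚ r))))

-- Prepending `0ℤ` is multiplication by q; associativity and the law of exponents both rest on this
-- case.
0∷-*ₚ : ∀ p r → (0ℤ ∷ p) *ₚ r ≋ 0ℤ ∷ (p *ₚ r)
0∷-*ₚ p r = +ₚ-cong (0·ₚ r) ≋-refl

*ₚ-assoc : ∀ p r s → (p *ₚ r) *ₚ s ≋ p *ₚ (r *ₚ s)
*ₚ-assoc []      r s = ≋-refl
*ₚ-assoc (a ∷ p) r s =
  ≋-trans (*ₚ-distribʳ s (a ·ₚ r) (0ℤ ∷ (p *ₚ r)))
  (+ₚ-cong (·ₚ-*ₚ a r s) (≋-trans (0∷-*ₚ (p *ₚ r) s) (∷-cong refl (*ₚ-assoc p r s))))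

*ₚ-identityˡ : ∀ p → 1ₚ *ₚ p ≋ p
*ₚ-identityˡ p = ≋-trans (+ₚ-cong (1·ₚ p) (coeffs (∷≈0 refl λ _ → refl))) (+ₚ-identityʳ p)

ℤ[q]-commutativeRing : CommutativeRing 0ℓ 0ℓ
ℤ[q]-commutativeRing = record
  { Carrier = ℤ[q]
  ; _≈_     = _≋_
  ; _+_     = _+ₚ_
  ; _*_     = _*ₚ_
  ; -_      = -ₚ_
  ; 0#      = 0ₚ
  ; 1#      = 1ₚ
  ; isCommutativeRing = record
    { isRing = record
      { +-isAbelianGroup = record
        { isGroup = record
          { isMonoid = record
            { isSemigroup = record
              { isMagma = record { isEquivalence = ≋-isEquivalence ; ∙-cong = +ₚ-cong }
              ; assoc   = +ₚ-assoc
              }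
            ; identity = (λ _ → ≋-refl) , +ₚ-identityʳ
            }
          ; inverse = -ₚ-inverseˡ , -ₚ-inverseʳ
          ; ⁻¹-cong = -ₚ-cong
          }
        ; comm = +ₚ-comm
        }
      ; *-cong     = *ₚ-cong
      ; *-assoc    = *ₚ-assoc
      ; *-identity = *ₚ-identityˡ , λ p → ≋-trans (*ₚ-comm p 1ₚ) (*ₚ-identityˡ p)
      ; distrib    = *ₚ-distribˡ , *ₚ-distribʳ
      }
    ; *-comm = *ₚ-comm
    }
  }

-- Lets the ring solver discard vanishing coefficients, including nonempty lists of zeros such as
-- `1ₚ +ₚ -ₚ 1ₚ`.
0ₚ≟_ : ∀ p → Maybe (0ₚ ≋ p)
0ₚ≟ []      = just ≋-refl
0ₚ≟ (a ∷ p) with a ℤₚ.≟ 0ℤ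
... | yes a≡0 = Maybe.map (λ e → ≋-sym (coeffs (∷≈0 a≡0 (at (≋-sym e))))) (0ₚ≟ p)
... | no  _   = nothing

ring : ACR.AlmostCommutativeRing 0ℓ 0ℓ
ring = ACR.fromCommutativeRing ℤ[q]-commutativeRing 0ₚ≟_

open ≋-Reasoning (CommutativeRing.setoid ℤ[q]-commutativeRing)

-- There are no zero divisors, and p (r - s) = 0. This replaces every division by a q-factorial
-- below.
*ₚ-cancelˡ : ∀ p {r s} → ¬ (p ≈ₚ 0ₚ) → p *ₚ r ≋ p *ₚ s → r ≋ s
*ₚ-cancelˡ p {r} {s} p≉0 e with *ₚ-integral p (r +ₚ -ₚ s) (at p*[r-s]≋0)
  where
  p*[r-s]≋0 : p *ₚ (r +ₚ -ₚ s) ≋ 0ₚ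
  p*[r-s]≋0 = begin
    p *ₚ (r +ₚ -ₚ s)         ≈⟨ expand p r s ⟩
    p *ₚ r +ₚ -ₚ (p *ₚ s)    ≈⟨ +ₚ-cong e ≋-refl ⟩
    p *ₚ s +ₚ -ₚ (p *ₚ s)    ≈⟨ -ₚ-inverseʳ (p *ₚ s) ⟩
    0ₚ                       ∎
    where
    expand : ∀ p r s → p *ₚ (r +ₚ -ₚ s) ≋ p *ₚ r +ₚ -ₚ (p *ₚ s)
    expand = solve-∀ ring
... | inj₁ p≈0   = contradiction p≈0 p≉0
... | inj₂ r-s≈0 = begin
    r                   ≈⟨ add-sub r s ⟩
    (r +ₚ -ₚ s) +ₚ s    ≈⟨ +ₚ-cong {r +ₚ -ₚ s} (coeffs r-s≈0) ≋-refl ⟩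
    s                   ∎
  where
  add-sub : ∀ r s → r ≋ (r +ₚ -ₚ s) +ₚ s
  add-sub = solve-∀ ring

-- Polynomials with non-negative coefficients.

record NonNeg (p : ℤ[q]) : Set where
  constructor nonNeg
  field 0≤coeff : ∀ i → 0ℤ ℤ.≤ coeff p i
open NonNeg

nonNeg-resp : ∀ {p r} → p ≋ r → NonNeg r → NonNeg p
nonNeg-resp e nn = nonNeg λ i → subst (0ℤ ℤ.≤_) (sym (at e i)) (0≤coeff nn i)

nonNeg-0 : NonNeg 0ₚ
nonNeg-0 = nonNeg λ i → ℤₚ.≤-refl

nonNeg-∷ : ∀ {a p} → 0ℤ ℤ.≤ a → NonNeg p → NonNeg (a ∷ p)
nonNeg-∷ 0≤a nn = nonNeg λ { zero → 0≤a ; (suc i) → 0≤coeff nn i }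

nonNeg-+ : ∀ {p r} → NonNeg p → NonNeg r → NonNeg (p +ₚ r)
nonNeg-+ {p} {r} nnp nnr = nonNeg λ i →
  subst (0ℤ ℤ.≤_) (sym (coeff-+ p r i)) (ℤₚ.+-mono-≤ (0≤coeff nnp i) (0≤coeff nnr i))

nonNeg-· : ∀ {a p} → 0ℤ ℤ.≤ a → NonNeg p → NonNeg (a ·ₚ p)
nonNeg-· {a} {p} 0≤a nn = nonNeg λ i →
  subst₂ ℤ._≤_ (ℤₚ.*-zeroʳ a) (sym (coeff-· a p i))
    (ℤₚ.*-monoˡ-≤-nonNeg a {{ℤ.nonNegative 0≤a}} (0≤coeff nn i))

nonNeg-* : ∀ {p r} → NonNeg p → NonNeg r → NonNeg (p *ₚ r)
nonNeg-* {[]}    nnp nnr = nonNeg-0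
nonNeg-* {a ∷ p} nnp nnr = nonNeg-+ (nonNeg-· (0≤coeff nnp 0) nnr)
  (nonNeg-∷ ℤₚ.≤-refl (nonNeg-* {p} (nonNeg λ i → 0≤coeff nnp (suc i)) nnr))

nonNeg-q^ : ∀ n → NonNeg (q^ n)
nonNeg-q^ zero    = nonNeg-∷ (ℤ.+≤+ ℕ.z≤n) nonNeg-0
nonNeg-q^ (suc n) = nonNeg-∷ ℤₚ.≤-refl (nonNeg-q^ n)

-- Powers of q, and Gaussian coefficients by Pascal's rule.

q^-+ : ∀ a b → q^ (a + b) ≋ q^ a *ₚ q^ b
q^-+ zero    b = ≋-sym (*ₚ-identityˡ (q^ b))
q^-+ (suc a) b = ≋-trans (∷-cong refl (q^-+ a b)) (≋-sym (0∷-*ₚ (q^ a) (q^ b)))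

1-q^0≋0 : 1-q^ 0 ≋ 0ₚ
1-q^0≋0 = -ₚ-inverseʳ 1ₚ

-- gauss n i is [n choose i - 1]: the shift provides [n choose -1] = 0, so that
-- Pascal's rule has no boundary case.
gauss : ℕ → ℕ → ℤ[q]
gauss n       zero          = 0ₚ
gauss zero    (suc zero)    = 1ₚ
gauss zero    (suc (suc i)) = 0ₚ
gauss (suc n) (suc i)       = q^ i *ₚ gauss n (suc i) +ₚ gauss n i

nonNeg-gauss : ∀ n i → NonNeg (gauss n i)
nonNeg-gauss n       zero          = nonNeg-0
nonNeg-gauss zero    (suc zero)    = nonNeg-q^ 0
nonNeg-gauss zero    (suc (suc i)) = nonNeg-0
nonNeg-gauss (suc n) (suc i)       =
  nonNeg-+ (nonNeg-* (nonNeg-q^ i) (nonNeg-gauss n (suc i))) (nonNeg-gauss n i)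

gauss-0 : ∀ n → gauss n 1 ≋ 1ₚ
gauss-0 zero    = ≋-refl
gauss-0 (suc n) = ≋-trans (+ₚ-identityʳ (1ₚ *ₚ gauss n 1)) (≋-trans (*ₚ-identityˡ (gauss n 1)) (gauss-0 n))

gauss-> : ∀ {n i} → suc n < i → gauss n i ≋ 0ₚ
gauss-> {zero}  {suc (suc i)} n<i       = ≋-refl
gauss-> {zero}  {suc zero}    (s<s ())
gauss-> {suc n} {suc i}       (s<s n<i) =
  +ₚ-cong (≋-trans (*ₚ-congˡ (q^ i) (gauss-> (ℕₚ.m<n⇒m<1+n n<i))) (*ₚ-zeroʳ (q^ i))) (gauss-> n<i)

gauss-diag : ∀ n → gauss n (suc n) ≋ 1ₚ
gauss-diag zero    = ≋-refl
gauss-diag (suc n) = +ₚ-cong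
  (≋-trans (*ₚ-congˡ (q^ suc n) (gauss-> {n} ℕₚ.≤-refl)) (*ₚ-zeroʳ (q^ suc n))) (gauss-diag n)

-- The factorial formula and ratios of neighbouring coefficients.

-- The q-Pochhammer symbol (q; q)_n, which is (1 - q)^n times the q-factorial of n.
φ : ℕ → ℤ[q]
φ zero    = 1ₚ
φ (suc n) = φ n *ₚ 1-q^ suc n

φ≉0 : ∀ n → ¬ (φ n ≈ₚ 0ₚ)
φ≉0 zero    = 1ₚ≉0
φ≉0 (suc n) = *ₚ-≉0 (φ n) (1-q^ suc n) (φ≉0 n) (1-q^n≉0 (suc n))

-- Pascal's rule splits the left side in two, and the induction closes with q^a (1 - q^b) + (1 -
-- q^a) = 1 - q^(a + b) for a = k + 1, b = l + 1. Writing the upper index as `k + l` avoids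
-- truncated subtraction.
gauss-φ : ∀ k l → gauss (k + l) (suc k) *ₚ φ k *ₚ φ l ≋ φ (k + l)
gauss-φ zero l = begin
  gauss l 1 *ₚ 1ₚ *ₚ φ l    ≈⟨ *ₚ-cong (*ₚ-cong (gauss-0 l) ≋-refl) ≋-refl ⟩
  1ₚ *ₚ φ l                 ≈⟨ *ₚ-identityˡ (φ l) ⟩
  φ l                       ∎
gauss-φ (suc k) zero rewrite ℕₚ.+-identityʳ k = begin
  gauss (suc k) (2 + k) *ₚ φ (suc k) *ₚ 1ₚ    ≈⟨ *ₚ-cong (*ₚ-cong (gauss-diag (suc k)) ≋-refl) ≋-refl ⟩
  1ₚ *ₚ φ (suc k) *ₚ 1ₚ                       ≈⟨ units (φ (suc k)) ⟩
  φ (suc k)                                   ∎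
  where
  units : ∀ p → 1ₚ *ₚ p *ₚ 1ₚ ≋ p
  units = solve-∀ ring
gauss-φ (suc k) (suc l) = begin
  gauss (suc n) (2 + k) *ₚ φ (suc k) *ₚ φ (suc l)
    ≈⟨ split x y (gauss n (2 + k)) (gauss n (1 + k)) (φ k) (φ l) ⟩
  x *ₚ (1ₚ +ₚ -ₚ y) *ₚ (gauss n (2 + k) *ₚ φ (suc k) *ₚ φ l) +ₚ
  (1ₚ +ₚ -ₚ x) *ₚ (gauss n (1 + k) *ₚ φ k *ₚ φ (suc l))
    ≈⟨ +ₚ-cong (*ₚ-congˡ (x *ₚ (1ₚ +ₚ -ₚ y)) left) (*ₚ-congˡ (1ₚ +ₚ -ₚ x) (gauss-φ k (suc l))) ⟩
  x *ₚ (1ₚ +ₚ -ₚ y) *ₚ φ n +ₚ (1ₚ +ₚ -ₚ x) *ₚ φ n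
    ≈⟨ collect x y (φ n) ⟩
  φ n *ₚ (1ₚ +ₚ -ₚ (x *ₚ y))
    ≈⟨ *ₚ-congˡ (φ n) (+ₚ-cong {1ₚ} ≋-refl (-ₚ-cong (≋-sym (q^-+ (suc k) (suc l))))) ⟩
  φ (suc n) ∎
  where
  n = k + suc l
  x = q^ suc k
  y = q^ suc l

  -- Reads n as `suc k + l`, the form that the induction hypothesis expects.
  left : gauss n (2 + k) *ₚ φ (suc k) *ₚ φ l ≋ φ n
  left rewrite ℕₚ.+-suc k l = gauss-φ (suc k) l

  split : ∀ x y a b f g →
    (x *ₚ a +ₚ b) *ₚ (f *ₚ (1ₚ +ₚ -ₚ x)) *ₚ (g *ₚ (1ₚ +ₚ -ₚ y)) ≋
    x *ₚ (1ₚ +ₚ -ₚ y) *ₚ (a *ₚ (f *ₚ (1ₚ +ₚ -ₚ x)) *ₚ g) +ₚ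
    (1ₚ +ₚ -ₚ x) *ₚ (b *ₚ f *ₚ (g *ₚ (1ₚ +ₚ -ₚ y)))
  split = solve-∀ ring

  collect : ∀ x y f →
    x *ₚ (1ₚ +ₚ -ₚ y) *ₚ f +ₚ (1ₚ +ₚ -ₚ x) *ₚ f ≋ f *ₚ (1ₚ +ₚ -ₚ (x *ₚ y))
  collect = solve-∀ ring

-- For l > 0, multiplying by `φ k *ₚ φ l` with l lowered by one turns both sides into the factorial
-- formula for the same n, split once at k + 1 and once at k.
gauss-sucʳ : ∀ k l →
  gauss (k + l) (2 + k) *ₚ 1-q^ suc k ≋ gauss (k + l) (1 + k) *ₚ 1-q^ l
-- Here the left side contains [k choose k + 1] = 0 and the right side 1 - q^0 = 0.
gauss-sucʳ k zero rewrite ℕₚ.+-identityʳ k = begin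
  gauss k (2 + k) *ₚ 1-q^ suc k    ≈⟨ *ₚ-cong (gauss-> {k} ℕₚ.≤-refl) ≋-refl ⟩
  0ₚ                               ≈⟨ *ₚ-zeroʳ (gauss k (1 + k)) ⟨
  gauss k (1 + k) *ₚ 0ₚ            ≈⟨ *ₚ-congˡ (gauss k (1 + k)) 1-q^0≋0 ⟨
  gauss k (1 + k) *ₚ 1-q^ 0        ∎
gauss-sucʳ k (suc l) = *ₚ-cancelˡ (φ k *ₚ φ l) (*ₚ-≉0 (φ k) (φ l) (φ≉0 k) (φ≉0 l)) (begin
  φ k *ₚ φ l *ₚ (gauss n (2 + k) *ₚ 1-q^ suc k)    ≈⟨ left (φ k) (φ l) (gauss n (2 + k)) (1-q^ suc k) ⟩
  gauss n (2 + k) *ₚ φ (suc k) *ₚ φ l              ≈⟨ lower ⟩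
  φ n                                              ≈⟨ gauss-φ k (suc l) ⟨
  gauss n (1 + k) *ₚ φ k *ₚ φ (suc l)              ≈⟨ right (φ k) (φ l) (gauss n (1 + k)) (1-q^ suc l) ⟩
  φ k *ₚ φ l *ₚ (gauss n (1 + k) *ₚ 1-q^ suc l)    ∎)
  where
  n = k + suc l

  lower : gauss n (2 + k) *ₚ φ (suc k) *ₚ φ l ≋ φ n
  lower rewrite ℕₚ.+-suc k l = gauss-φ (suc k) l

  left : ∀ f g a x → f *ₚ g *ₚ (a *ₚ x) ≋ a *ₚ (f *ₚ x) *ₚ g
  left = solve-∀ ring

  right : ∀ f g a x → a *ₚ f *ₚ (g *ₚ x) ≋ f *ₚ g *ₚ (a *ₚ x)
  right = solve-∀ ring

-- The ratio `gauss-sucʳ` one place lower. For k = 0 both sides vanish, since the shifted index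
-- makes [l choose -1] zero.
gauss-predʳ : ∀ k l →
  gauss (k + l) k *ₚ 1-q^ suc l ≋ gauss (k + l) (1 + k) *ₚ 1-q^ k
gauss-predʳ zero l = ≋-sym
  (≋-trans (*ₚ-congˡ (gauss l 1) 1-q^0≋0) (*ₚ-zeroʳ (gauss l 1)))
gauss-predʳ (suc k) l =
  subst (λ n → gauss n (1 + k) *ₚ 1-q^ suc l ≋ gauss n (2 + k) *ₚ 1-q^ suc k)
    (ℕₚ.+-suc k l) (≋-sym (gauss-sucʳ k (suc l)))

-- Non-negativity of the minors.

-- minor n k j d is the 2 × 2 minor
--   [n choose k] [n choose j - 1] - q^d [n choose k - 1] [n choose j],
-- which is non-negative for j = k + d (and zero for d = 0).
minor : ℕ → ℕ → ℕ → ℕ → ℤ[q]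
minor n k j d =
  gauss n (suc k) *ₚ gauss n j +ₚ -ₚ (q^ d *ₚ (gauss n k *ₚ gauss n (suc j)))

minor-d0 : ∀ n k → minor n k k 0 ≋ 0ₚ
minor-d0 n k = antisym (gauss n (suc k)) (gauss n k)
  where
  antisym : ∀ a b → a *ₚ b +ₚ -ₚ (1ₚ *ₚ (b *ₚ a)) ≋ 0ₚ
  antisym = solve-∀ ring

-- The subtracted product contains [n choose -1] = 0.
minor-k0 : ∀ n j d → minor n 0 j d ≋ gauss n j
minor-k0 n j d = begin
  gauss n 1 *ₚ gauss n j +ₚ -ₚ (q^ d *ₚ 0ₚ)
    ≈⟨ +ₚ-cong (*ₚ-cong (gauss-0 n) ≋-refl) ≋-refl ⟩
  1ₚ *ₚ gauss n j +ₚ -ₚ (q^ d *ₚ 0ₚ)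
    ≈⟨ simplify (gauss n j) (q^ d) ⟩
  gauss n j ∎
  where
  simplify : ∀ b y → 1ₚ *ₚ b +ₚ -ₚ (y *ₚ 0ₚ) ≋ b
  simplify = solve-∀ ring

-- The ring solver treats powers of q as atoms, so identities between exponents have to enter
-- separately.
q^-*-cong : ∀ a b c d → a + b ≡ c + d → q^ a *ₚ q^ b ≋ q^ c *ₚ q^ d
q^-*-cong a b c d e =
  ≋-trans (≋-sym (q^-+ a b)) (≋-trans (≋-reflexive (cong q^_ e)) (q^-+ c d))

-- Applying Pascal's rule to all four entries gives eight products, which pair off into four minors.
-- All of them share the value of j - k - d, so the condition j = d + k survives the recursion.
minor-pascal : ∀ n k j d →
  minor (suc n) (suc k) (suc j) (suc d) ≋
    ((q^ suc k *ₚ q^ j *ₚ minor n (suc k) (suc j) (suc d) +ₚ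
      q^ suc k *ₚ minor n (suc k) j d) +ₚ
     q^ j *ₚ minor n k (suc j) (2 + d)) +ₚ
    minor n k j (suc d)
minor-pascal n k j d = begin
  minor (suc n) (suc k) (suc j) (suc d)
    ≈⟨ expand (q^ k) (q^ suc k) (q^ j) (q^ suc j) (q^ suc d) a₀ a₁ a₂ b₁ b₂ b₃ ⟩
  common +ₚ -ₚ (q^ suc d *ₚ (q^ k *ₚ q^ suc j) *ₚ (a₁ *ₚ b₃) +ₚ
    q^ suc d *ₚ q^ k *ₚ (a₁ *ₚ b₂) +ₚ q^ suc d *ₚ q^ suc j *ₚ (a₀ *ₚ b₃))
    -- Three subtracted products need their powers of q rewritten to match their partners; the
    -- fourth already has the right power and sits in `common`.
    ≈⟨ +ₚ-cong {common} ≋-refl (-ₚ-cong (+ₚ-cong (+ₚ-cong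
         (*ₚ-cong (*ₚ-congˡ (q^ suc d) (q^-*-cong k (suc j) (suc k) j (ℕₚ.+-suc k j))) ≋-refl)
         (*ₚ-cong (q^-*-cong (suc d) k (suc k) d (cong suc (ℕₚ.+-comm d k))) ≋-refl))
         (*ₚ-cong (q^-*-cong (suc d) (suc j) j (2 + d)
           (trans (cong suc (trans (ℕₚ.+-suc d j) (cong suc (ℕₚ.+-comm d j))))
             (sym (trans (ℕₚ.+-suc j (suc d)) (cong suc (ℕₚ.+-suc j d)))))) ≋-refl))) ⟩
  common +ₚ -ₚ (q^ suc d *ₚ (q^ suc k *ₚ q^ j) *ₚ (a₁ *ₚ b₃) +ₚ
    q^ suc k *ₚ q^ d *ₚ (a₁ *ₚ b₂) +ₚ q^ j *ₚ q^ (2 + d) *ₚ (a₀ *ₚ b₃))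
    ≈⟨ collect (q^ suc k) (q^ j) (q^ d) (q^ suc d) (q^ (2 + d)) a₀ a₁ a₂ b₁ b₂ b₃ ⟩
  ((q^ suc k *ₚ q^ j *ₚ minor n (suc k) (suc j) (suc d) +ₚ
    q^ suc k *ₚ minor n (suc k) j d) +ₚ
   q^ j *ₚ minor n k (suc j) (2 + d)) +ₚ
  minor n k j (suc d) ∎
  where
  a₀ = gauss n k
  a₁ = gauss n (1 + k)
  a₂ = gauss n (2 + k)
  b₁ = gauss n j
  b₂ = gauss n (1 + j)
  b₃ = gauss n (2 + j)
  common = q^ suc k *ₚ q^ j *ₚ (a₂ *ₚ b₂) +ₚ q^ suc k *ₚ (a₂ *ₚ b₁) +ₚ
    q^ j *ₚ (a₁ *ₚ b₂) +ₚ a₁ *ₚ b₁ +ₚ -ₚ (q^ suc d *ₚ (a₀ *ₚ b₂))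

  expand : ∀ x x′ y y′ z′ a₀ a₁ a₂ b₁ b₂ b₃ →
    (x′ *ₚ a₂ +ₚ a₁) *ₚ (y *ₚ b₂ +ₚ b₁) +ₚ
    -ₚ (z′ *ₚ ((x *ₚ a₁ +ₚ a₀) *ₚ (y′ *ₚ b₃ +ₚ b₂))) ≋
    (x′ *ₚ y *ₚ (a₂ *ₚ b₂) +ₚ x′ *ₚ (a₂ *ₚ b₁) +ₚ
     y *ₚ (a₁ *ₚ b₂) +ₚ a₁ *ₚ b₁ +ₚ -ₚ (z′ *ₚ (a₀ *ₚ b₂))) +ₚ
    -ₚ (z′ *ₚ (x *ₚ y′) *ₚ (a₁ *ₚ b₃) +ₚ z′ *ₚ x *ₚ (a₁ *ₚ b₂) +ₚ z′ *ₚ y′ *ₚ (a₀ *ₚ b₃))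
  expand = solve-∀ ring

  collect : ∀ x′ y z z′ z″ a₀ a₁ a₂ b₁ b₂ b₃ →
    (x′ *ₚ y *ₚ (a₂ *ₚ b₂) +ₚ x′ *ₚ (a₂ *ₚ b₁) +ₚ
     y *ₚ (a₁ *ₚ b₂) +ₚ a₁ *ₚ b₁ +ₚ -ₚ (z′ *ₚ (a₀ *ₚ b₂))) +ₚ
    -ₚ (z′ *ₚ (x′ *ₚ y) *ₚ (a₁ *ₚ b₃) +ₚ x′ *ₚ z *ₚ (a₁ *ₚ b₂) +ₚ y *ₚ z″ *ₚ (a₀ *ₚ b₃)) ≋
      ((x′ *ₚ y *ₚ (a₂ *ₚ b₂ +ₚ -ₚ (z′ *ₚ (a₁ *ₚ b₃))) +ₚ
        x′ *ₚ (a₂ *ₚ b₁ +ₚ -ₚ (z *ₚ (a₁ *ₚ b₂)))) +ₚ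
       y *ₚ (a₁ *ₚ b₂ +ₚ -ₚ (z″ *ₚ (a₀ *ₚ b₃)))) +ₚ
      (a₁ *ₚ b₁ +ₚ -ₚ (z′ *ₚ (a₀ *ₚ b₂)))
  collect = solve-∀ ring

-- Induction on n: `minor-pascal` writes the minor as a combination of smaller ones with powers of q
-- as weights. The gap d may grow to d + 2, but n always drops.
nonNeg-minor : ∀ n k {j} d → j ≡ d + k → NonNeg (minor n k j d)
nonNeg-minor n       zero {j} d    e    = nonNeg-resp (minor-k0 n j d) (nonNeg-gauss n j)
nonNeg-minor n       (suc k) zero    refl = nonNeg-resp (minor-d0 n (suc k)) nonNeg-0
-- Both k and j are positive in `minor 0 k j d`, so [0 choose k] = [0 choose j] = 0 and each product
-- vanishes.
nonNeg-minor zero    (suc k) (suc d) refl = nonNeg-resp (minor-n0 (gauss 0 (suc k)) (q^ suc d)) nonNeg-0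
  where
  minor-n0 : ∀ a z → 0ₚ *ₚ 0ₚ +ₚ -ₚ (z *ₚ (a *ₚ 0ₚ)) ≋ 0ₚ
  minor-n0 = solve-∀ ring
nonNeg-minor (suc n) (suc k) (suc d) refl =
  nonNeg-resp (minor-pascal n k j d)
    (nonNeg-+ (nonNeg-+ (nonNeg-+
      (nonNeg-* (nonNeg-* (nonNeg-q^ (suc k)) (nonNeg-q^ j))
        (nonNeg-minor n (suc k) (suc d) refl))
      (nonNeg-* (nonNeg-q^ (suc k)) (nonNeg-minor n (suc k) d refl)))
      (nonNeg-* (nonNeg-q^ j) (nonNeg-minor n k (2 + d) (cong suc (ℕₚ.+-suc d k)))))
      (nonNeg-minor n k (suc d) (ℕₚ.+-suc d k)))
  where
  -- One less than the index j of the goal, as `minor-pascal` takes predecessors.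
  j = d + suc k

-- The q-Narayana numbers and their factorial formula.

-- At q = 1 this is the number of Dyck paths of semilength k + l + 1 with k + 1 peaks. In the
-- theorem k = m - 1 and l = n - 1.
narayana : ℕ → ℕ → ℤ[q]
narayana k l = minor (k + l) k (suc k) 1

narayana-φ : ∀ k l →
  narayana k l *ₚ φ k *ₚ φ l *ₚ φ (suc k) *ₚ φ (suc l) ≋
  1-q^ 1 *ₚ φ (k + l) *ₚ φ (k + suc l)
narayana-φ k l = begin
  narayana k l *ₚ φ k *ₚ φ l *ₚ φ (suc k) *ₚ φ (suc l)
    -- The last factors of `φ (suc l)` and `φ (suc k)` go to `a⁻` and `a⁺`, making both multiples of
    -- `a` by the ratio lemmas.
    ≈⟨ expand (q^ 1) a a⁻ a⁺ (φ k) (φ l) (1-q^ suc k) (1-q^ suc l) ⟩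
  (a *ₚ a *ₚ (1-q^ suc k *ₚ 1-q^ suc l) +ₚ
    -ₚ (q^ 1 *ₚ (a⁻ *ₚ 1-q^ suc l) *ₚ (a⁺ *ₚ 1-q^ suc k))) *ₚ
  (φ k *ₚ φ l *ₚ φ k *ₚ φ l)
    ≈⟨ *ₚ-cong (+ₚ-cong
         (*ₚ-congˡ (a *ₚ a) (*ₚ-cong (1-q^-cong (q^-+ 1 k)) (1-q^-cong (q^-+ 1 l))))
         (-ₚ-cong (*ₚ-cong (*ₚ-congˡ (q^ 1) (gauss-predʳ k l)) (gauss-sucʳ k l)))) ≋-refl ⟩
  (a *ₚ a *ₚ ((1ₚ +ₚ -ₚ (q^ 1 *ₚ q^ k)) *ₚ (1ₚ +ₚ -ₚ (q^ 1 *ₚ q^ l))) +ₚ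
    -ₚ (q^ 1 *ₚ (a *ₚ 1-q^ k) *ₚ (a *ₚ 1-q^ l))) *ₚ
  (φ k *ₚ φ l *ₚ φ k *ₚ φ l)
    -- With u = q^k and v = q^l this is (1 - qu)(1 - qv) - q(1 - u)(1 - v) = (1 - q)(1 - quv).
    ≈⟨ factor (q^ 1) (q^ k) (q^ l) a (φ k) (φ l) ⟩
  1-q^ 1 *ₚ (a *ₚ φ k *ₚ φ l) *ₚ
  ((a *ₚ φ k *ₚ φ l) *ₚ (1ₚ +ₚ -ₚ (q^ 1 *ₚ (q^ k *ₚ q^ l))))
    ≈⟨ *ₚ-cong (*ₚ-congˡ (1-q^ 1) (gauss-φ k l))
         (*ₚ-cong (gauss-φ k l) (≋-sym (1-q^-cong q^-k+l+1))) ⟩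
  1-q^ 1 *ₚ φ (k + l) *ₚ φ (suc (k + l))
    ≈⟨ *ₚ-congˡ (1-q^ 1 *ₚ φ (k + l)) (≋-reflexive (cong φ (sym (ℕₚ.+-suc k l)))) ⟩
  1-q^ 1 *ₚ φ (k + l) *ₚ φ (k + suc l) ∎
  where
  a  = gauss (k + l) (1 + k)
  a⁻ = gauss (k + l) k
  a⁺ = gauss (k + l) (2 + k)

  1-q^-cong : ∀ {p r} → p ≋ r → 1ₚ +ₚ -ₚ p ≋ 1ₚ +ₚ -ₚ r
  1-q^-cong e = +ₚ-cong {1ₚ} ≋-refl (-ₚ-cong e)

  q^-k+l+1 : q^ suc (k + l) ≋ q^ 1 *ₚ (q^ k *ₚ q^ l)
  q^-k+l+1 = ≋-trans (q^-+ 1 (k + l)) (*ₚ-congˡ (q^ 1) (q^-+ k l))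

  expand : ∀ q a a⁻ a⁺ f g x y →
    (a *ₚ a +ₚ -ₚ (q *ₚ (a⁻ *ₚ a⁺))) *ₚ f *ₚ g *ₚ (f *ₚ x) *ₚ (g *ₚ y) ≋
    (a *ₚ a *ₚ (x *ₚ y) +ₚ -ₚ (q *ₚ (a⁻ *ₚ y) *ₚ (a⁺ *ₚ x))) *ₚ (f *ₚ g *ₚ f *ₚ g)
  expand = solve-∀ ring

  factor : ∀ q u v a f g →
    (a *ₚ a *ₚ ((1ₚ +ₚ -ₚ (q *ₚ u)) *ₚ (1ₚ +ₚ -ₚ (q *ₚ v))) +ₚ
      -ₚ (q *ₚ (a *ₚ (1ₚ +ₚ -ₚ u)) *ₚ (a *ₚ (1ₚ +ₚ -ₚ v)))) *ₚ (f *ₚ g *ₚ f *ₚ g) ≋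
    (1ₚ +ₚ -ₚ q) *ₚ (a *ₚ f *ₚ g) *ₚ
    ((a *ₚ f *ₚ g) *ₚ (1ₚ +ₚ -ₚ (q *ₚ (u *ₚ v))))
  factor = solve-∀ ring

-- Numerators and denominators of the q-binomial coefficients.

den-∏₁ : ∀ c k → den (∏₁ k λ i → [1-q^ c + i ]/[1-q^ i ]) ≡ φ k
den-∏₁ c zero    = refl
den-∏₁ c (suc k) = cong (_*ₚ 1-q^ suc k) (den-∏₁ c k)

-- The numerator consists of the top k factors of `φ (c + k)`, and `φ c` supplies the others.
num-∏₁ : ∀ c k → num (∏₁ k λ i → [1-q^ c + i ]/[1-q^ i ]) *ₚ φ c ≋ φ (c + k)
num-∏₁ c zero    = ≋-trans (*ₚ-identityˡ (φ c)) (≋-reflexive (cong φ (sym (ℕₚ.+-identityʳ c))))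
num-∏₁ c (suc k) = begin
  num (∏₁ k f) *ₚ 1-q^ (c + suc k) *ₚ φ c      ≈⟨ swap (num (∏₁ k f)) (1-q^ (c + suc k)) (φ c) ⟩
  num (∏₁ k f) *ₚ φ c *ₚ 1-q^ (c + suc k)      ≈⟨ *ₚ-cong (num-∏₁ c k) ≋-refl ⟩
  φ (c + k) *ₚ 1-q^ (c + suc k)                ≈⟨ *ₚ-congˡ (φ (c + k)) (≋-reflexive (cong 1-q^_ (ℕₚ.+-suc c k))) ⟩
  φ (suc (c + k))                              ≈⟨ ≋-reflexive (cong φ (sym (ℕₚ.+-suc c k))) ⟩
  φ (c + suc k)                                ∎
  where
  f : (i : ℕ) .{{_ : NonZero i}} → ℚ⟨q⟩
  f i = [1-q^ c + i ]/[1-q^ i ]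

  swap : ∀ p r s → p *ₚ r *ₚ s ≋ p *ₚ s *ₚ r
  swap = solve-∀ ring

-- The equation encodes k ≤ n with c as the difference, and leaves n free to be an expression such
-- as `m + n ∸ 2`.
den-qbinom : ∀ {n} c k → n ≡ c + k → den (qbinom n k) ≡ φ k
den-qbinom {n} c k e with k ℕₚ.≤? n
... | yes _   = den-∏₁ (n ∸ k) k
... | no  k≰n = contradiction (subst (k ≤_) (sym e) (ℕₚ.m≤n+m k c)) k≰n

num-qbinom : ∀ {n} c k → n ≡ c + k → num (qbinom n k) *ₚ φ c ≋ φ n
num-qbinom {n} c k refl with k ℕₚ.≤? n
... | yes _   rewrite ℕₚ.m+n∸n≡m c k = num-∏₁ c k
... | no  k≰n = contradiction (ℕₚ.m≤n+m k c) k≰n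

qbinom-> : ∀ {n k} → n < k → qbinom n k ≡ fromPoly 0ₚ
qbinom-> {n} {k} n<k with k ℕₚ.≤? n
... | yes k≤n = contradiction k≤n (ℕₚ.<⇒≱ n<k)
... | no  _   = refl

-- The product as a polynomial.

-- This is `_≃_` unfolded, with e = n - m and `1ₚ` the denominator of `fromPoly`. The Gaussian
-- coefficient is [2n choose n - m]. Multiplying by `φ l *ₚ φ e *ₚ φ n` completes the three binomial
-- numerators to full q-factorials.
product-≋ : ∀ k l e → suc l ≡ e + suc k → let m = suc k; n = suc l in
  num ([1-q^ 1 ]/[1-q^ m + n ] * qbinom (m + n ∸ 2) k * qbinom n m * qbinom (2 ℕ.* n) n) *ₚ 1ₚ ≋
  gauss (e + (m + n)) (suc e) *ₚ narayana k l *ₚ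
  den ([1-q^ 1 ]/[1-q^ m + n ] * qbinom (m + n ∸ 2) k * qbinom n m * qbinom (2 ℕ.* n) n)
product-≋ k l e n≡e+m =
  *ₚ-cancelˡ (φ l *ₚ φ e *ₚ φ n) (*ₚ-≉0 (φ l *ₚ φ e) (φ n) (*ₚ-≉0 (φ l) (φ e) (φ≉0 l) (φ≉0 e)) (φ≉0 n)) (begin
    φ l *ₚ φ e *ₚ φ n *ₚ (s *ₚ N₁ *ₚ N₂ *ₚ N₃ *ₚ 1ₚ)
      ≈⟨ regroup-num (φ l) (φ e) (φ n) s N₁ N₂ N₃ ⟩
    s *ₚ (N₁ *ₚ φ l) *ₚ (N₂ *ₚ φ e) *ₚ (N₃ *ₚ φ n)
      ≈⟨ *ₚ-cong (*ₚ-cong (*ₚ-congˡ s (num-qbinom l k m+n∸2≡l+k)) (num-qbinom e m n≡e+m)) (num-qbinom n n 2n≡n+n) ⟩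
    s *ₚ φ (m + n ∸ 2) *ₚ φ n *ₚ φ (2 ℕ.* n)
      ≈⟨ *ₚ-cong (*ₚ-cong (*ₚ-congˡ s (≋-reflexive (cong φ (trans m+n∸2≡l+k (ℕₚ.+-comm l k))))) ≋-refl)
           (≋-reflexive (cong φ 2n≡e+m+n)) ⟩
    s *ₚ φ (k + l) *ₚ φ n *ₚ φ (e + (m + n))
      -- Splits `φ (2 ℕ.* n)` at n - m. The last factor of `φ (m + n)` is `t`, the denominator 1 -
      -- q^(m + n) of the leading fraction.
      ≈⟨ *ₚ-congˡ (s *ₚ φ (k + l) *ₚ φ n) (gauss-φ e (m + n)) ⟨
    s *ₚ φ (k + l) *ₚ φ n *ₚ (G *ₚ φ e *ₚ (φ (k + n) *ₚ t))
      ≈⟨ exchange s (φ (k + l)) (φ n) G (φ e) (φ (k + n)) t ⟩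
    G *ₚ t *ₚ φ e *ₚ φ n *ₚ (s *ₚ φ (k + l) *ₚ φ (k + n))
      ≈⟨ *ₚ-congˡ (G *ₚ t *ₚ φ e *ₚ φ n) (narayana-φ k l) ⟨
    G *ₚ t *ₚ φ e *ₚ φ n *ₚ (narayana k l *ₚ φ k *ₚ φ l *ₚ φ m *ₚ φ n)
      ≈⟨ regroup-den G t (φ e) (φ n) (narayana k l) (φ k) (φ l) (φ m) ⟩
    φ l *ₚ φ e *ₚ φ n *ₚ (G *ₚ narayana k l *ₚ (t *ₚ φ k *ₚ φ m *ₚ φ n))
      ≈⟨ *ₚ-congˡ (φ l *ₚ φ e *ₚ φ n) (*ₚ-congˡ (G *ₚ narayana k l) (≋-reflexive den-≡)) ⟨
    φ l *ₚ φ e *ₚ φ n *ₚ (G *ₚ narayana k l *ₚ (t *ₚ D₁ *ₚ D₂ *ₚ D₃)) ∎)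
  where
  m = suc k
  n = suc l
  s = 1-q^ 1
  t = 1-q^ (m + n)
  G = gauss (e + (m + n)) (suc e)
  N₁ = num (qbinom (m + n ∸ 2) k)
  N₂ = num (qbinom n m)
  N₃ = num (qbinom (2 ℕ.* n) n)
  D₁ = den (qbinom (m + n ∸ 2) k)
  D₂ = den (qbinom n m)
  D₃ = den (qbinom (2 ℕ.* n) n)

  m+n∸2≡l+k : m + n ∸ 2 ≡ l + k
  m+n∸2≡l+k = trans (cong (_∸ 1) (ℕₚ.+-suc k l)) (ℕₚ.+-comm k l)

  2n≡n+n : 2 ℕ.* n ≡ n + n
  2n≡n+n = cong (n +_) (ℕₚ.+-identityʳ n)

  2n≡e+m+n : 2 ℕ.* n ≡ e + (m + n)
  2n≡e+m+n = trans 2n≡n+n (trans (cong (_+ n) n≡e+m) (ℕₚ.+-assoc e m n))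

  den-≡ : t *ₚ D₁ *ₚ D₂ *ₚ D₃ ≡ t *ₚ φ k *ₚ φ m *ₚ φ n
  den-≡ = cong₂ _*ₚ_ (cong₂ _*ₚ_ (cong (t *ₚ_) (den-qbinom l k m+n∸2≡l+k)) (den-qbinom e m n≡e+m))
    (den-qbinom n n 2n≡n+n)

  regroup-num : ∀ f g h s n₁ n₂ n₃ →
    f *ₚ g *ₚ h *ₚ (s *ₚ n₁ *ₚ n₂ *ₚ n₃ *ₚ 1ₚ) ≋
    s *ₚ (n₁ *ₚ f) *ₚ (n₂ *ₚ g) *ₚ (n₃ *ₚ h)
  regroup-num = solve-∀ ring

  exchange : ∀ s f h G g f′ t →
    s *ₚ f *ₚ h *ₚ (G *ₚ g *ₚ (f′ *ₚ t)) ≋ G *ₚ t *ₚ g *ₚ h *ₚ (s *ₚ f *ₚ f′)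
  exchange = solve-∀ ring

  regroup-den : ∀ G t g h N a b c →
    G *ₚ t *ₚ g *ₚ h *ₚ (N *ₚ a *ₚ b *ₚ c *ₚ h) ≋
    b *ₚ g *ₚ h *ₚ (G *ₚ N *ₚ (t *ₚ a *ₚ c *ₚ h))
  regroup-den = solve-∀ ring

theorem3 : (m n : ℕ) .{{_ : NonZero m}} .{{_ : NonZero n}} →
    IsNonNegPolynomial
    ([1-q^ 1 ]/[1-q^ m + n ] * qbinom (m + n ∸ 2) (m ∸ 1) * qbinom n m * qbinom (2 ℕ.* n) n)
theorem3 m@(suc k) n@(suc l) with ℕₚ.≤-<-connex m n
... | inj₁ m≤n =
  gauss (n ∸ m + (m + n)) (suc (n ∸ m)) *ₚ narayana k l ,
  at (product-≋ k l (n ∸ m) (sym (ℕₚ.m∸n+n≡m m≤n))) ,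
  0≤coeff (nonNeg-* (nonNeg-gauss (n ∸ m + (m + n)) (suc (n ∸ m))) (nonNeg-minor (k + l) k 1 refl))
-- Now [n choose m] = 0, so the whole product is zero.
... | inj₂ n<m rewrite qbinom-> n<m =
  0ₚ , at (zero-num (num ([1-q^ 1 ]/[1-q^ m + n ] * qbinom (m + n ∸ 2) k)) (num (qbinom (2 ℕ.* n) n))) , 0≤coeff nonNeg-0
  where
  zero-num : ∀ p r → p *ₚ 0ₚ *ₚ r *ₚ 1ₚ ≋ 0ₚ
  zero-num = solve-∀ ring
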